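{- The varieties $\mathbb{RDBLP}$ (regular double p-algebras), $\mathbb{RDPCH}$ (regular dually pseudocomplemented Heyting algebras), $\mathbb{RPCH}^d$ (regular pseudocomplemented dual Heyting algebras) and $\mathbb{RDBLH}$ (regular double Heyting algebras) are pairwise term-equivalent.
   Context: All algebras below have a bounded distributive lattice reduct $\langle A,\vee,\wedge,0,1\rangle$. Notation for the operations: $x^*$ is the largest $z$ with $x\wedge z=0$; $x^+$ is the least $z$ with $x\vee z=1$; $x\to y$ is the largest $z$ with $x\wedge z\le y$; $x\leftarrow y$ is the least $z$ with $y\le x\vee z$. Where ${}^*$ is not basic, $x^*:=x\to 0$; where ${}^+$ is not basic, $x^+:=x\leftarrow 1$. The regularity identity is (M): $(x\wedge x^+)\vee(y\vee y^*)\approx y\vee y^*$ (for double p-algebras it is known to be equivalent to: $x^*=y^*$ and $x^+=y^+$ imply $x=y$). $\mathbb{RDBLP}$: algebras $\langle A,\vee,\wedge,{}^*,{}^+,0,1\rangle$ satisfying (M). $\mathbb{RDPCH}$: algebras $\langle A,\vee,\wedge,\to,{}^+,0,1\rangle$ satisfying (M). $\mathbb{RPCH}^d$: algebras $\langle A,\vee,\wedge,{}^*,\leftarrow,0,1\rangle$ satisfying (M). $\mathbb{RDBLH}$: algebras $\langle A,\vee,\wedge,\to,\leftarrow,0,1\rangle$ satisfying (M). Two varieties $\mathbb V,\mathbb W$ are term-equivalent if each basic operation symbol of $\mathbb W$ can be assigned a term of the same arity in the language of $\mathbb V$, and conversely, so that replacing the basic operations of $\mathbf A\in\mathbb V$ by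 the assigned term operations gives (on the same universe) an algebra in $\mathbb W$, and conversely, and these two constructions are mutually inverse. Here $\vee,\wedge,0,1$ are kept unchanged. -}

module Defs where

open import Level using (Level; _⊔_; suc)
open import Data.Nat.Base using (ℕ)
open import Data.Fin.Base using (Fin)
open import Data.Product.Base using (_×_)
open import Data.Sum.Base using (_⊎_; inj₁; inj₂; [_,_])
open import Data.Vec.Functional using (Vector; []; _∷_)
open import Algebra.Core using (Op₁; Op₂)
import Algebra.Definitions as AlgebraDefinitions
import Algebra.Lattice.Structures as LatticeStructures
open import Relation.Binary.Bundles using (Setoid)
import Relation.Binary.Construct.NaturalOrder.Left as NaturalOrder
open import Relation.Binary.PropositionalEquality.Core using (_≡_)

record Signature : Set₁ where
  field
    Symbol : Set
    arity  : Symbol → ℕ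

open Signature public

data Term (S : Signature) (n : ℕ) : Set where
  var : Fin n → Term S n
  app : (f : Symbol S) → Vector (Term S n) (arity S f) → Term S n

record Algebra (S : Signature) (c ℓ : Level) : Set (suc (c ⊔ ℓ)) where
  field
    setoid : Setoid c ℓ

  open Setoid setoid public

  field
    ⟦_⟧    : (f : Symbol S) → Vector Carrier (arity S f) → Carrier
    ⟦⟧-cong : ∀ f {xs ys : Vector Carrier (arity S f)} →
              (∀ i → xs i ≈ ys i) → ⟦ f ⟧ xs ≈ ⟦ f ⟧ ys

module _ {S : Signature} {c ℓ : Level} (A : Algebra S c ℓ) where
  open Algebra A

  eval : ∀ {n} → Term S n → Vector Carrier n → Carrier
  eval (var i)    ρ = ρ i
  eval (app f ts) ρ = ⟦ f ⟧ (λ i → eval (ts i) ρ)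

  eval-cong : ∀ {n} (t : Term S n) {ρ σ : Vector Carrier n} →
              (∀ i → ρ i ≈ σ i) → eval t ρ ≈ eval t σ
  eval-cong (var i)    ρ≈σ = ρ≈σ i
  eval-cong (app f ts) ρ≈σ = ⟦⟧-cong f (λ i → eval-cong (ts i) ρ≈σ)

-- Each symbol of T is assigned a term of the same arity in the language S.
Translation : Signature → Signature → Set
Translation S T = (f : Symbol T) → Term S (arity T f)

translate : ∀ {S T c ℓ} → Translation S T → Algebra S c ℓ → Algebra T c ℓ
translate τ A = record
  { setoid  = Algebra.setoid A
  ; ⟦_⟧     = λ f → eval A (τ f)
  ; ⟦⟧-cong = λ f → eval-cong A (τ f)
  }

data LatticeSymbol : Set where
  join meet bot top : LatticeSymbol

latticeArity : LatticeSymbol → ℕ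
latticeArity join = 2
latticeArity meet = 2
latticeArity bot  = 0
latticeArity top  = 0

-- The language of bounded lattices together with the symbols of S.
expansion : Signature → Signature
expansion S = record
  { Symbol = LatticeSymbol ⊎ Symbol S
  ; arity  = [ latticeArity , arity S ]
  }

FixesLattice : ∀ {S T} → Translation (expansion S) (expansion T) → Set
FixesLattice τ = ∀ f → τ (inj₁ f) ≡ app (inj₁ f) var

record LatticeClass (c ℓ : Level) : Set (suc (c ⊔ ℓ)) where
  field
    extra  : Signature
    Member : Algebra (expansion extra) c ℓ → Set (c ⊔ ℓ)

  signature : Signature
  signature = expansion extra

record TermEquivalent {c ℓ : Level} (V W : LatticeClass c ℓ) :
                      Set (suc (c ⊔ ℓ)) where
  private
    module V = LatticeClass V
    module W = LatticeClass W

  field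
    to   : Translation V.signature W.signature
    from : Translation W.signature V.signature

    to-fixes   : FixesLattice to
    from-fixes : FixesLattice from

    to-member   : ∀ A → V.Member A → W.Member (translate to A)
    from-member : ∀ B → W.Member B → V.Member (translate from B)

    from∘to : ∀ A → V.Member A → let open Algebra A in
              ∀ f xs → Algebra.⟦_⟧ (translate from (translate to A)) f xs ≈ ⟦ f ⟧ xs
    to∘from : ∀ B → W.Member B → let open Algebra B in
              ∀ f xs → Algebra.⟦_⟧ (translate to (translate from B)) f xs ≈ ⟦ f ⟧ xs

module LatticeReduct {S : Signature} {c ℓ : Level}
                     (A : Algebra (expansion S) c ℓ) where
  open Algebra A public
  open AlgebraDefinitions _≈_ using (Identity)
  open LatticeStructures _≈_ using (IsDistributiveLattice)

  infixr 7 _∧_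
  infixr 6 _∨_

  _∨_ _∧_ : Op₂ Carrier
  x ∨ y = ⟦ inj₁ join ⟧ (x ∷ y ∷ [])
  x ∧ y = ⟦ inj₁ meet ⟧ (x ∷ y ∷ [])

  𝟎 𝟏 : Carrier
  𝟎 = ⟦ inj₁ bot ⟧ []
  𝟏 = ⟦ inj₁ top ⟧ []

  -- x ≤ y unfolds to x ≈ x ∧ y.
  open NaturalOrder _≈_ _∧_ public using (_≤_)

  record IsBoundedDistributiveLattice : Set (c ⊔ ℓ) where
    field
      isDistributiveLattice : IsDistributiveLattice _∨_ _∧_
      ∨-identity            : Identity 𝟎 _∨_
      ∧-identity            : Identity 𝟏 _∧_

  IsLargest IsLeast : (Carrier → Set ℓ) → Carrier → Set (c ⊔ ℓ)
  IsLargest P z = P z × (∀ w → P w → w ≤ z)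
  IsLeast   P z = P z × (∀ w → P w → z ≤ w)

  IsPseudocomplement IsDualPseudocomplement : Op₁ Carrier → Set (c ⊔ ℓ)
  IsPseudocomplement     _* = ∀ x → IsLargest (λ z → x ∧ z ≈ 𝟎) (x *)
  IsDualPseudocomplement _⁺ = ∀ x → IsLeast   (λ z → x ∨ z ≈ 𝟏) (x ⁺)

  IsImplication IsDualImplication : Op₂ Carrier → Set (c ⊔ ℓ)
  IsImplication     _⇒_ = ∀ x y → IsLargest (λ z → (x ∧ z) ≤ y) (x ⇒ y)
  IsDualImplication _⇐_ = ∀ x y → IsLeast   (λ z → y ≤ (x ∨ z)) (x ⇐ y)

  Regular : Op₁ Carrier → Op₁ Carrier → Set (c ⊔ ℓ)
  Regular _* _⁺ = ∀ x y → (x ∧ (x ⁺)) ∨ (y ∨ (y *)) ≈ y ∨ (y *)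

data DBLPSymbol : Set where
  star plus : DBLPSymbol

DBLPSignature : Signature
DBLPSignature = record
  { Symbol = DBLPSymbol
  ; arity  = λ { star → 1 ; plus → 1 }
  }

data DPCHSymbol : Set where
  imp plus : DPCHSymbol

DPCHSignature : Signature
DPCHSignature = record
  { Symbol = DPCHSymbol
  ; arity  = λ { imp → 2 ; plus → 1 }
  }

data PCHᵈSymbol : Set where
  star coimp : PCHᵈSymbol

PCHᵈSignature : Signature
PCHᵈSignature = record
  { Symbol = PCHᵈSymbol
  ; arity  = λ { star → 1 ; coimp → 2 }
  }

data DBLHSymbol : Set where
  imp coimp : DBLHSymbol

DBLHSignature : Signature
DBLHSignature = record
  { Symbol = DBLHSymbol
  ; arity  = λ { imp → 2 ; coimp → 2 }
  }

module _ {c ℓ : Level} where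

  record IsRDBLP (A : Algebra (expansion DBLPSignature) c ℓ) : Set (c ⊔ ℓ) where
    open LatticeReduct A

    _* : Op₁ Carrier
    x * = ⟦ inj₂ star ⟧ (x ∷ [])

    _⁺ : Op₁ Carrier
    x ⁺ = ⟦ inj₂ plus ⟧ (x ∷ [])

    field
      isBoundedDistributiveLattice : IsBoundedDistributiveLattice
      isPseudocomplement           : IsPseudocomplement _*
      isDualPseudocomplement       : IsDualPseudocomplement _⁺
      regular                      : Regular _* _⁺

  record IsRDPCH (A : Algebra (expansion DPCHSignature) c ℓ) : Set (c ⊔ ℓ) where
    open LatticeReduct A

    _⇒_ : Op₂ Carrier
    x ⇒ y = ⟦ inj₂ imp ⟧ (x ∷ y ∷ [])

    _* : Op₁ Carrier
    x * = x ⇒ 𝟎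

    _⁺ : Op₁ Carrier
    x ⁺ = ⟦ inj₂ plus ⟧ (x ∷ [])

    field
      isBoundedDistributiveLattice : IsBoundedDistributiveLattice
      isImplication                : IsImplication _⇒_
      isDualPseudocomplement       : IsDualPseudocomplement _⁺
      regular                      : Regular _* _⁺

  record IsRPCHᵈ (A : Algebra (expansion PCHᵈSignature) c ℓ) : Set (c ⊔ ℓ) where
    open LatticeReduct A

    _⇐_ : Op₂ Carrier
    x ⇐ y = ⟦ inj₂ coimp ⟧ (x ∷ y ∷ [])

    _* : Op₁ Carrier
    x * = ⟦ inj₂ star ⟧ (x ∷ [])

    _⁺ : Op₁ Carrier
    x ⁺ = x ⇐ 𝟏

    field
      isBoundedDistributiveLattice : IsBoundedDistributiveLattice
      isPseudocomplement           : IsPseudocomplement _*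
      isDualImplication            : IsDualImplication _⇐_
      regular                      : Regular _* _⁺

  record IsRDBLH (A : Algebra (expansion DBLHSignature) c ℓ) : Set (c ⊔ ℓ) where
    open LatticeReduct A

    _⇒_ : Op₂ Carrier
    x ⇒ y = ⟦ inj₂ imp   ⟧ (x ∷ y ∷ [])

    _⇐_ : Op₂ Carrier
    x ⇐ y = ⟦ inj₂ coimp ⟧ (x ∷ y ∷ [])

    _* : Op₁ Carrier
    x * = x ⇒ 𝟎

    _⁺ : Op₁ Carrier
    x ⁺ = x ⇐ 𝟏

    field
      isBoundedDistributiveLattice : IsBoundedDistributiveLattice
      isImplication                : IsImplication _⇒_
      isDualImplication            : IsDualImplication _⇐_
      regular                      : Regular _* _⁺

RDBLP RDPCH RPCHᵈ RDBLH : ∀ c ℓ → LatticeClass c ℓ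
RDBLP c ℓ = record { extra = DBLPSignature ; Member = IsRDBLP }
RDPCH c ℓ = record { extra = DPCHSignature ; Member = IsRDPCH }
RPCHᵈ c ℓ = record { extra = PCHᵈSignature ; Member = IsRPCHᵈ }
RDBLH c ℓ = record { extra = DBLHSignature ; Member = IsRDBLH }

{-# OPTIONS --safe #-}

-- In a regular double p-algebra the relative pseudocomplement exists and is given by the term
--   x → y = (x ∧ y*)* ∧ ((x ∨ x*)⁺ ∨ x* ∨ y),
-- and dually for x ← y.  Indeed x ∧ (x ∨ x*)⁺ ≤ y ∨ y* by (M), so x meets the right-hand side
-- inside y ∨ y*, while (x ∧ y*)* removes y*; conversely x ∧ z ≤ y gives
--   z = z ∧ (x ∨ x* ∨ (x ∨ x*)⁺) ≤ y ∨ x* ∨ (x ∨ x*)⁺.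
-- All four operations are determined by the order, and so is (M); hence any two choices of basic
-- operations define each other and the translations are mutually inverse.
module Submission where

open import Defs
open import Level using (Level; _⊔_)
open import Algebra.Core using (Op₁; Op₂)
open import Algebra.Definitions using (_DistributesOverˡ_)
open import Algebra.Lattice.Structures using (module IsDistributiveLattice)
import Algebra.Lattice.Properties.DistributiveLattice as DistributiveLatticeProperties
open import Data.Fin.Base using (zero; suc)
open import Data.List.Base using (_∷_; [])
open import Data.List.Relation.Unary.All using (_∷_; [])
open import Data.List.Relation.Unary.AllPairs using (AllPairs; _∷_; [])
open import Data.Nat.Base using (ℕ)
open import Data.Product.Base using (_×_; _,_; proj₁; proj₂)
open import Data.Sum.Base using (inj₁; inj₂)
open import Data.Vec.Functional using (Vector) renaming ([] to []ᵛ; _∷_ to _∷ᵛ_)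
open import Function.Base using (flip; id)
open import Relation.Binary.Core using (Rel)
import Relation.Binary.Lattice as Order
import Relation.Binary.Lattice.Properties.Lattice as OrderLatticeProperties
import Relation.Binary.PropositionalEquality.Core as ≡

-- Relative pseudocomplements in bounded distributive lattices.

module BoundedDistributive
  {a ℓ₁ ℓ₂} {A : Set a} {_≈_ : Rel A ℓ₁} {_≤_ : Rel A ℓ₂} {_∨_ _∧_ : Op₂ A} {𝟏 𝟎 : A}
  (isBoundedLattice : Order.IsBoundedLattice _≈_ _≤_ _∨_ _∧_ 𝟏 𝟎)
  (∧-distribˡ-∨ : _DistributesOverˡ_ _≈_ _∧_ _∨_)
  where

  open Order.IsBoundedLattice isBoundedLattice

  -- Stated over an arbitrary order, so that at the flipped order it unfolds to `IsLeast` and every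
  -- lemma below also yields its dual.
  Largest : ∀ {p} → (A → Set p) → A → Set _
  Largest P z = P z × (∀ w → P w → w ≤ z)

  largest-unique : ∀ {p} {P : A → Set p} {y z} → Largest P y → Largest P z → y ≈ z
  largest-unique (Py , y-max) (Pz , z-max) = antisym (z-max _ Py) (y-max _ Pz)

  largest-resp : ∀ {p} {P : A → Set p} {y z} → (∀ {v w} → v ≈ w → P v → P w) → y ≈ z →
                 Largest P y → Largest P z
  largest-resp P-resp y≈z (Py , y-max) =
    P-resp y≈z Py , λ w Pw → trans (y-max w Pw) (reflexive y≈z)

  largest-map : ∀ {p q} {P : A → Set p} {Q : A → Set q} {z} →
                (∀ {w} → P w → Q w) → (∀ {w} → Q w → P w) → Largest P z → Largest Q z
  largest-map P⇒Q Q⇒P (Pz , z-max) = P⇒Q Pz , λ w Qw → z-max w (Q⇒P Qw)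

  ∧-mono : ∀ {w x y z} → w ≤ x → y ≤ z → (w ∧ y) ≤ (x ∧ z)
  ∧-mono w≤x y≤z = ∧-greatest (trans (x∧y≤x _ _) w≤x) (trans (x∧y≤y _ _) y≤z)

  ≤𝟎⇒≈𝟎 : ∀ {x} → x ≤ 𝟎 → x ≈ 𝟎
  ≤𝟎⇒≈𝟎 x≤𝟎 = antisym x≤𝟎 (minimum _)

  ≈𝟎⇒≤ : ∀ {x y} → x ≈ 𝟎 → x ≤ y
  ≈𝟎⇒≤ x≈𝟎 = trans (reflexive x≈𝟎) (minimum _)

  -- Distributivity as case analysis: `w` is the join of its parts below `x` and below `y`.
  ≤∨-elim : ∀ {w x y z} → w ≤ (x ∨ y) → (w ∧ x) ≤ z → (w ∧ y) ≤ z → w ≤ z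
  ≤∨-elim w≤x∨y wx≤z wy≤z =
    trans (∧-greatest refl w≤x∨y)
          (trans (reflexive (∧-distribˡ-∨ _ _ _)) (∨-least wx≤z wy≤z))

  -- Here `q` stands for `(x ∧ y*)*` and `r` for `(x ∨ x*)⁺`; the last hypothesis is (M) at `x ∨ x*`
  -- and `y`. Passing these as elements with properties, not as values of operations, lets the
  -- statement be dualized.
  relativePseudocomplement : ∀ {x y x* y* q r} →
    (x ∧ x*) ≈ 𝟎 → Largest (λ w → (y ∧ w) ≈ 𝟎) y* →
    Largest (λ w → ((x ∧ y*) ∧ w) ≈ 𝟎) q →
    ((x ∨ x*) ∨ r) ≈ 𝟏 → ((x ∨ x*) ∧ r) ≤ (y ∨ y*) →
    Largest (λ w → (x ∧ w) ≤ y) (q ∧ ((r ∨ x*) ∨ y))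
  relativePseudocomplement {x} {y} {x*} {y*} {q} {r}
    x∧x*≈𝟎 (y∧y*≈𝟎 , _) (xy*q≈𝟎 , q-max) n∨r≈𝟏 n∧r≤y∨y* = below , largest
    where
    t = q ∧ ((r ∨ x*) ∨ y)

    -- Cases along the second factor of `t`: the part in `r` uses `x ≤ x ∨ x*` and regularity, the
    -- part in `x*` is disjoint from `x`, the part in `y` is immediate.
    x∧t≤y∨y* : (x ∧ t) ≤ (y ∨ y*)
    x∧t≤y∨y* = ≤∨-elim (trans (x∧y≤y _ _) (x∧y≤y _ _))
      (≤∨-elim (x∧y≤y _ _)
        (trans (∧-mono (trans (x∧y≤x _ _) (trans (x∧y≤x _ _) (x≤x∨y _ _))) refl) n∧r≤y∨y*)
        (trans (∧-mono (trans (x∧y≤x _ _) (x∧y≤x _ _)) refl) (≈𝟎⇒≤ x∧x*≈𝟎)))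
      (trans (x∧y≤y _ _) (x≤x∨y _ _))

    below : (x ∧ t) ≤ y
    below = ≤∨-elim x∧t≤y∨y* (x∧y≤y _ _)
      -- The part in `y*` lies below both `x ∧ y*` and `q`, which are disjoint.
      (trans (∧-greatest (∧-mono (x∧y≤x _ _) refl)
                         (trans (x∧y≤x _ _) (trans (x∧y≤y _ _) (x∧y≤x _ _))))
             (≈𝟎⇒≤ xy*q≈𝟎))

    largest : ∀ w → (x ∧ w) ≤ y → w ≤ t
    largest w x∧w≤y = ∧-greatest
      -- `(x ∧ y*) ∧ w` lies below both `y` and `y*`, so it vanishes and maximality of `q` applies.
      (q-max w (≤𝟎⇒≈𝟎 (trans
        (∧-greatest (trans (∧-mono (x∧y≤x _ _) refl) x∧w≤y)
                    (trans (x∧y≤x _ _) (x∧y≤y _ _)))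
        (reflexive y∧y*≈𝟎))))
      (≤∨-elim (trans (maximum w) (reflexive (Eq.sym n∨r≈𝟏)))
        (≤∨-elim (x∧y≤y _ _)
          (trans (∧-greatest (x∧y≤y _ _) (trans (x∧y≤x _ _) (x∧y≤x _ _)))
                 (trans x∧w≤y (y≤x∨y _ _)))
          (trans (x∧y≤y _ _) (trans (y≤x∨y _ _) (x≤x∨y _ _))))
        (trans (x∧y≤y _ _) (trans (x≤x∨y _ _) (x≤x∨y _ _))))

-- The four operations as described by the lattice order.

data Operation : ℕ → Set where
  pseudocomplement dualPseudocomplement : Operation 1
  implication      dualImplication      : Operation 2

module Reduct {S : Signature} {c ℓ : Level} (A : Algebra (expansion S) c ℓ) where
  open LatticeReduct A

  -- A relation rather than a function: it makes sense in every expansion, whether or not the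
  -- operation is basic there, and it mentions lattice symbols only.
  Describes : ∀ {n} → Operation n → Vector Carrier n → Carrier → Set (c ⊔ ℓ)
  Describes pseudocomplement     xs = IsLargest (λ w → xs zero ∧ w ≈ 𝟎)
  Describes dualPseudocomplement xs = IsLeast   (λ w → xs zero ∨ w ≈ 𝟏)
  Describes implication          xs = IsLargest (λ w → (xs zero ∧ w) ≤ xs (suc zero))
  Describes dualImplication      xs = IsLeast   (λ w → xs (suc zero) ≤ (xs zero ∨ w))

  -- Vectors are functions, so vectors with the same entries need not be judgmentally equal;
  -- congruence of `⟦_⟧` along these proofs bridges the gap.
  pointwise₁ : {xs ys : Vector Carrier 1} → xs zero ≈ ys zero → ∀ i → xs i ≈ ys i
  pointwise₁ x≈y zero = x≈y

  pointwise₂ : {xs ys : Vector Carrier 2} → xs zero ≈ ys zero →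
               xs (suc zero) ≈ ys (suc zero) → ∀ i → xs i ≈ ys i
  pointwise₂ x≈y _   zero       = x≈y
  pointwise₂ _   x≈y (suc zero) = x≈y

  ∧-cong : ∀ {w x y z} → w ≈ x → y ≈ z → w ∧ y ≈ x ∧ z
  ∧-cong w≈x y≈z = ⟦⟧-cong (inj₁ meet) (pointwise₂ w≈x y≈z)

  ∨-cong : ∀ {w x y z} → w ≈ x → y ≈ z → w ∨ y ≈ x ∨ z
  ∨-cong w≈x y≈z = ⟦⟧-cong (inj₁ join) (pointwise₂ w≈x y≈z)

  ≤-resp : ∀ {w x y z} → w ≈ x → y ≈ z → w ≤ y → x ≤ z
  ≤-resp w≈x y≈z w≤y = trans (sym w≈x) (trans w≤y (∧-cong w≈x y≈z))

  -- (M) as an inequality between any elements that happen to be `x⁺` and `y*`. This form is common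
  -- to all four signatures; existence of such elements is a separate matter.
  record IsRegularReduct : Set (c ⊔ ℓ) where
    field
      isBoundedDistributiveLattice : IsBoundedDistributiveLattice
      regular : ∀ {x x⁺ y y*} → Describes dualPseudocomplement (x ∷ᵛ []ᵛ) x⁺ →
                Describes pseudocomplement (y ∷ᵛ []ᵛ) y* → (x ∧ x⁺) ≤ (y ∨ y*)

  module Properties (isBDL : IsBoundedDistributiveLattice) where
    open IsBoundedDistributiveLattice isBDL
    open IsDistributiveLattice isDistributiveLattice using (∧-distribˡ-∨; ∨-distribˡ-∧)

    private
      orderLattice = DistributiveLatticeProperties.∨-∧-orderTheoreticLattice
        (record { isDistributiveLattice = isDistributiveLattice })

    open Order.Lattice orderLattice public using (antisym; x≤x∨y; y≤x∨y; ∨-least)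
      renaming (reflexive to ≤-reflexive; refl to ≤-refl; trans to ≤-trans)

    maximum : ∀ x → x ≤ 𝟏
    maximum x = sym (proj₂ ∧-identity x)

    minimum : ∀ x → 𝟎 ≤ x
    minimum x = ≤-trans (x≤x∨y 𝟎 x) (≤-reflexive (proj₁ ∨-identity x))

    private
      isBoundedLattice : Order.IsBoundedLattice _≈_ _≤_ _∨_ _∧_ 𝟏 𝟎
      isBoundedLattice = record
        { isLattice = Order.Lattice.isLattice orderLattice
        ; maximum   = maximum
        ; minimum   = minimum
        }

      dualIsBoundedLattice : Order.IsBoundedLattice _≈_ (flip _≤_) _∧_ _∨_ 𝟎 𝟏
      dualIsBoundedLattice = record
        { isLattice = OrderLatticeProperties.∧-∨-isLattice orderLattice
        ; maximum   = minimum
        ; minimum   = maximum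
        }

    module Primal = BoundedDistributive isBoundedLattice ∧-distribˡ-∨
    -- In this instance `𝟎` and `𝟏` are exchanged: `≤𝟎⇒≈𝟎` says that an element above `𝟏` equals
    -- `𝟏`.
    module Dual   = BoundedDistributive dualIsBoundedLattice ∨-distribˡ-∧

    -- Two extremal elements for one predicate bound each other. This is what later makes the
    -- translations mutually inverse.
    describes-unique : ∀ {n} (o : Operation n) xs {y z} →
                       Describes o xs y → Describes o xs z → y ≈ z
    describes-unique pseudocomplement     _ = Primal.largest-unique
    describes-unique dualPseudocomplement _ = Dual.largest-unique
    describes-unique implication          _ = Primal.largest-unique
    describes-unique dualImplication      _ = Dual.largest-unique

    describes-resp : ∀ {n} (o : Operation n) xs {y z} → y ≈ z →
                     Describes o xs y → Describes o xs z
    describes-resp pseudocomplement     xs = Primal.largest-resp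
      (λ v≈w → trans (∧-cong refl (sym v≈w)))
    describes-resp dualPseudocomplement xs = Dual.largest-resp
      (λ v≈w → trans (∨-cong refl (sym v≈w)))
    describes-resp implication          xs = Primal.largest-resp
      (λ v≈w → ≤-resp (∧-cong refl v≈w) refl)
    describes-resp dualImplication      xs = Dual.largest-resp
      (λ v≈w → ≤-resp refl (∨-cong refl v≈w))

    pseudocomplement-cong : ∀ {x y z} → x ≈ y →
      Describes pseudocomplement (x ∷ᵛ []ᵛ) z → Describes pseudocomplement (y ∷ᵛ []ᵛ) z
    pseudocomplement-cong x≈y = Primal.largest-map
      (trans (∧-cong (sym x≈y) refl))
      (trans (∧-cong x≈y refl))

    dualPseudocomplement-cong : ∀ {x y z} → x ≈ y →
      Describes dualPseudocomplement (x ∷ᵛ []ᵛ) z → Describes dualPseudocomplement (y ∷ᵛ []ᵛ) z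
    dualPseudocomplement-cong x≈y = Dual.largest-map
      (trans (∨-cong (sym x≈y) refl))
      (trans (∨-cong x≈y refl))

    -- Being below `𝟎` means being equal to it, so the two predicates agree. The hypothesis is
    -- `y ≈ 𝟎` because an evaluated `𝟎ᵗ` is not judgmentally `𝟎`.
    implication⇒pseudocomplement : ∀ {x y z} → y ≈ 𝟎 →
      Describes implication (x ∷ᵛ y ∷ᵛ []ᵛ) z → Describes pseudocomplement (x ∷ᵛ []ᵛ) z
    implication⇒pseudocomplement y≈𝟎 = Primal.largest-map
      (λ x∧w≤y → Primal.≤𝟎⇒≈𝟎 (≤-resp refl y≈𝟎 x∧w≤y))
      Primal.≈𝟎⇒≤

    dualImplication⇒dualPseudocomplement : ∀ {x y z} → y ≈ 𝟏 →
      Describes dualImplication (x ∷ᵛ y ∷ᵛ []ᵛ) z → Describes dualPseudocomplement (x ∷ᵛ []ᵛ) z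
    dualImplication⇒dualPseudocomplement y≈𝟏 = Dual.largest-map
      (λ y≤x∨w → Dual.≤𝟎⇒≈𝟎 (≤-resp y≈𝟏 refl y≤x∨w))
      Dual.≈𝟎⇒≤

    -- (M) speaks of chosen operations; uniqueness carries it over to arbitrary described elements.
    isRegularReduct : ∀ {_* _⁺} → IsPseudocomplement _* → IsDualPseudocomplement _⁺ →
                      Regular _* _⁺ → IsRegularReduct
    isRegularReduct isPC isDPC M = record
      { isBoundedDistributiveLattice = isBDL
      ; regular = λ {x} {_} {y} x⁺ y* → ≤-resp
          (∧-cong refl (describes-unique dualPseudocomplement (x ∷ᵛ []ᵛ) (isDPC x) x⁺))
          (∨-cong refl (describes-unique pseudocomplement (y ∷ᵛ []ᵛ) (isPC y) y*))
          (≤-trans (x≤x∨y _ _) (≤-reflexive (M x y)))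
      }

  module RegularProperties (isReg : IsRegularReduct) where
    open IsRegularReduct isReg
    open Properties isBoundedDistributiveLattice public

    -- Converse of `isRegularReduct`: the smaller element is absorbed by the join, which turns the
    -- inequality back into the identity.
    satisfiesM : ∀ {_* _⁺} → IsPseudocomplement _* → IsDualPseudocomplement _⁺ → Regular _* _⁺
    satisfiesM isPC isDPC x y = antisym (∨-least (regular (isDPC x) (isPC y)) ≤-refl) (y≤x∨y _ _)

    implication-formula : ∀ {x y x* y* q r} →
      Describes pseudocomplement (x ∷ᵛ []ᵛ) x* → Describes pseudocomplement (y ∷ᵛ []ᵛ) y* →
      Describes pseudocomplement (x ∧ y* ∷ᵛ []ᵛ) q →
      Describes dualPseudocomplement (x ∨ x* ∷ᵛ []ᵛ) r →
      Describes implication (x ∷ᵛ y ∷ᵛ []ᵛ) (q ∧ ((r ∨ x*) ∨ y))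
    implication-formula x* y* q r =
      Primal.relativePseudocomplement (proj₁ x*) y* q (proj₁ r) (regular r y*)

    dualImplication-formula : ∀ {x y x⁺ y⁺ q r} →
      Describes dualPseudocomplement (x ∷ᵛ []ᵛ) x⁺ → Describes dualPseudocomplement (y ∷ᵛ []ᵛ) y⁺ →
      Describes dualPseudocomplement (x ∨ y⁺ ∷ᵛ []ᵛ) q →
      Describes pseudocomplement (x ∧ x⁺ ∷ᵛ []ᵛ) r →
      Describes dualImplication (x ∷ᵛ y ∷ᵛ []ᵛ) (q ∨ ((r ∧ x⁺) ∧ y))
    dualImplication-formula x⁺ y⁺ q r =
      -- (M) is self-dual with its arguments exchanged: the dual hypothesis is
      -- `y ∧ y⁺ ≤ (x ∧ x⁺) ∨ r`, where `r` is the pseudocomplement of `x ∧ x⁺`.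
      Dual.relativePseudocomplement (proj₁ x⁺) y⁺ q (proj₁ r) (regular y⁺ r)

-- Terms that define the four operations.

module _ {S : Signature} {n : ℕ} where

  infixr 7 _∧ᵗ_
  infixr 6 _∨ᵗ_

  _∧ᵗ_ _∨ᵗ_ : Op₂ (Term (expansion S) n)
  s ∧ᵗ t = app (inj₁ meet) (s ∷ᵛ t ∷ᵛ []ᵛ)
  s ∨ᵗ t = app (inj₁ join) (s ∷ᵛ t ∷ᵛ []ᵛ)

  𝟎ᵗ 𝟏ᵗ : Term (expansion S) n
  𝟎ᵗ = app (inj₁ bot) []ᵛ
  𝟏ᵗ = app (inj₁ top) []ᵛ

-- A class whose members are exactly the regular reducts with basic operations chosen among the
-- four of Operation, in such a way that * and ⁺ are term-definable.
record Presentation {c ℓ : Level} (V : LatticeClass c ℓ) : Set (Level.suc (c ⊔ ℓ)) where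
  open LatticeClass V
  open Reduct using (Describes; IsRegularReduct)

  infix 8 _⋆ _⁺

  field
    operation : ∀ f → Operation (arity extra f)
    -- Operations on terms in any number of variables, so that nesting them in `term` calls for no
    -- substitution lemma.
    _⋆ _⁺     : ∀ {n} → Op₁ (Term signature n)

  IsDescribed : Algebra signature c ℓ → Set (c ⊔ ℓ)
  IsDescribed A = ∀ f xs → Describes A (operation f) xs (Algebra.⟦_⟧ A (inj₂ f) xs)

  field
    isRegularReduct : ∀ {A} → Member A → IsRegularReduct A
    isDescribed     : ∀ {A} → Member A → IsDescribed A
    isMember        : ∀ {A} → IsRegularReduct A → IsDescribed A → Member A
    ⋆-describes     : ∀ {A} → Member A → ∀ {n} (t : Term signature n) ρ →
                      Describes A pseudocomplement (eval A t ρ ∷ᵛ []ᵛ) (eval A (t ⋆) ρ)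
    ⁺-describes     : ∀ {A} → Member A → ∀ {n} (t : Term signature n) ρ →
                      Describes A dualPseudocomplement (eval A t ρ ∷ᵛ []ᵛ) (eval A (t ⁺) ρ)

  -- Uniform in the signature: even a basic implication receives the long formula, and its agreement
  -- with the basic symbol follows from uniqueness.
  term : ∀ {n} → Operation n → Term signature n
  term pseudocomplement     = var zero ⋆
  term dualPseudocomplement = var zero ⁺
  term implication          = (x ∧ᵗ y ⋆) ⋆ ∧ᵗ (((x ∨ᵗ x ⋆) ⁺ ∨ᵗ x ⋆) ∨ᵗ y)
    where x = var zero ; y = var (suc zero)
  term dualImplication      = (x ∨ᵗ y ⁺) ⁺ ∨ᵗ (((x ∧ᵗ x ⁺) ⋆ ∧ᵗ x ⁺) ∧ᵗ y)
    where x = var zero ; y = var (suc zero)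

  module _ {A : Algebra signature c ℓ} (A∈V : Member A) where
    open LatticeReduct A
    open Reduct A hiding (Describes; IsRegularReduct)
    open RegularProperties (isRegularReduct A∈V) hiding (isRegularReduct)

    private
      eval-∧ : ∀ {n} (s t : Term signature n) ρ → eval A (s ∧ᵗ t) ρ ≈ eval A s ρ ∧ eval A t ρ
      eval-∧ s t ρ = ⟦⟧-cong (inj₁ meet) (pointwise₂ refl refl)

      eval-∨ : ∀ {n} (s t : Term signature n) ρ → eval A (s ∨ᵗ t) ρ ≈ eval A s ρ ∨ eval A t ρ
      eval-∨ s t ρ = ⟦⟧-cong (inj₁ join) (pointwise₂ refl refl)

    term-describes : ∀ {n} (o : Operation n) xs → Describes A o xs (eval A (term o) xs)
    term-describes pseudocomplement     xs = ⋆-describes A∈V (var zero) xs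
    term-describes dualPseudocomplement xs = ⁺-describes A∈V (var zero) xs
    term-describes implication          xs =
      describes-resp implication xs
        -- Only the outer meet and the two joins are unfolded; subterms under `⋆` and `⁺` stay
        -- whole, since `⋆-describes` and `⁺-describes` apply to arbitrary terms.
        (sym (trans (eval-∧ ((x ∧ᵗ y ⋆) ⋆) (((x ∨ᵗ x ⋆) ⁺ ∨ᵗ x ⋆) ∨ᵗ y) xs) (∧-cong refl
          (trans (eval-∨ ((x ∨ᵗ x ⋆) ⁺ ∨ᵗ x ⋆) y xs)
                 (∨-cong (eval-∨ ((x ∨ᵗ x ⋆) ⁺) (x ⋆) xs) refl)))))
        (implication-formula (⋆-describes A∈V x xs) (⋆-describes A∈V y xs)
          (pseudocomplement-cong (eval-∧ x (y ⋆) xs)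
            (⋆-describes A∈V (x ∧ᵗ y ⋆) xs))
          (dualPseudocomplement-cong (eval-∨ x (x ⋆) xs)
            (⁺-describes A∈V (x ∨ᵗ x ⋆) xs)))
      where x = var zero ; y = var (suc zero)
    term-describes dualImplication      xs =
      describes-resp dualImplication xs
        (sym (trans (eval-∨ ((x ∨ᵗ y ⁺) ⁺) (((x ∧ᵗ x ⁺) ⋆ ∧ᵗ x ⁺) ∧ᵗ y) xs) (∨-cong refl
          (trans (eval-∧ ((x ∧ᵗ x ⁺) ⋆ ∧ᵗ x ⁺) y xs)
                 (∧-cong (eval-∧ ((x ∧ᵗ x ⁺) ⋆) (x ⁺) xs) refl)))))
        (dualImplication-formula (⁺-describes A∈V x xs) (⁺-describes A∈V y xs)
          (dualPseudocomplement-cong (eval-∨ x (y ⁺) xs)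
            (⁺-describes A∈V (x ∨ᵗ y ⁺) xs))
          (pseudocomplement-cong (eval-∧ x (x ⁺) xs)
            (⋆-describes A∈V (x ∧ᵗ x ⁺) xs)))
      where x = var zero ; y = var (suc zero)

-- Translations between presented classes.

module _ {c ℓ : Level} {V W : LatticeClass c ℓ} (P : Presentation V) (Q : Presentation W) where
  private
    module V = LatticeClass V
    module W = LatticeClass W
    module P = Presentation P
    module Q = Presentation Q

  translation : Translation V.signature W.signature
  translation (inj₁ f) = app (inj₁ f) var
  translation (inj₂ f) = P.term (Q.operation f)

  -- A translation keeps the carrier, `≈` and the lattice symbols judgmentally. The split on `o`
  -- only lets `Describes` reduce.
  translation-describes : ∀ (A : Algebra V.signature c ℓ) {n} (o : Operation n) {xs z} →
    Reduct.Describes A o xs z → Reduct.Describes (translate translation A) o xs z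
  translation-describes A pseudocomplement     = id
  translation-describes A dualPseudocomplement = id
  translation-describes A implication          = id
  translation-describes A dualImplication      = id

  translation-member : ∀ A → V.Member A → W.Member (translate translation A)
  translation-member A A∈V = Q.isMember {translate translation A}
    (record
      -- The record types for the two algebras differ although their fields agree judgmentally,
      -- hence the repacking.
      { isBoundedDistributiveLattice = record
          { isDistributiveLattice = isDistributiveLattice
          ; ∨-identity            = ∨-identity
          ; ∧-identity            = ∧-identity
          }
      ; regular = regular
      })
    (λ f xs → translation-describes A (Q.operation f) (P.term-describes A∈V (Q.operation f) xs))
    where
    open Reduct.IsRegularReduct (P.isRegularReduct A∈V)
    open LatticeReduct.IsBoundedDistributiveLattice isBoundedDistributiveLattice

-- The round-trip value and the original one satisfy the same order description, so the nested terms
-- never have to be computed. The comparison takes place in the intermediate algebra.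
translation-inverse : ∀ {c ℓ} {V W : LatticeClass c ℓ} (P : Presentation V) (Q : Presentation W) →
  ∀ A → LatticeClass.Member V A → let open Algebra A in ∀ f xs →
  Algebra.⟦_⟧ (translate (translation Q P) (translate (translation P Q) A)) f xs ≈ ⟦ f ⟧ xs
translation-inverse P Q A A∈V (inj₁ f) xs = Algebra.refl A
translation-inverse P Q A A∈V (inj₂ f) xs =
  describes-unique (P.operation f) xs
    (Q.term-describes B∈W (P.operation f) xs)
    (translation-describes P Q A (P.operation f) (P.isDescribed A∈V f xs))
  where
  module P = Presentation P
  module Q = Presentation Q
  B∈W = translation-member P Q A A∈V
  open Reduct.RegularProperties (translate (translation P Q) A) (Q.isRegularReduct B∈W)
    using (describes-unique)

termEquivalent : ∀ {c ℓ} {V W : LatticeClass c ℓ} →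
                 Presentation V → Presentation W → TermEquivalent V W
termEquivalent P Q = record
  { to          = translation P Q
  ; from        = translation Q P
  ; to-fixes    = λ _ → ≡.refl
  ; from-fixes  = λ _ → ≡.refl
  ; to-member   = translation-member P Q
  ; from-member = translation-member Q P
  ; from∘to     = translation-inverse P Q
  ; to∘from     = translation-inverse Q P
  }

-- Presentations of the four varieties.

rdblp : ∀ {c ℓ} → Presentation (RDBLP c ℓ)
rdblp {c} {ℓ} = record
  { operation       = operation
  ; _⋆              = λ t → app (inj₂ star) (t ∷ᵛ []ᵛ)
  ; _⁺              = λ t → app (inj₂ plus) (t ∷ᵛ []ᵛ)
  ; isRegularReduct = isRegularReduct
  ; isDescribed     = isDescribed
  ; isMember        = isMember
  ; ⋆-describes     = λ A∈V t ρ → isDescribed A∈V star _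
  ; ⁺-describes     = λ A∈V t ρ → isDescribed A∈V plus _
  }
  where
  operation : ∀ f → Operation (arity DBLPSignature f)
  operation star = pseudocomplement
  operation plus = dualPseudocomplement

  module _ {A : Algebra (expansion DBLPSignature) c ℓ} where
    open LatticeReduct A
    open Reduct A

    IsDescribed : Set (c ⊔ ℓ)
    IsDescribed = ∀ f xs → Describes (operation f) xs (⟦ inj₂ f ⟧ xs)

    -- The class axioms describe a symbol at literal vectors such as `x ∷ []`; congruence extends
    -- this to arbitrary `xs`.
    isDescribed : IsRDBLP A → IsDescribed
    isDescribed A∈V = λ
      { star xs → describes-resp pseudocomplement xs
          (⟦⟧-cong (inj₂ star) (pointwise₁ refl))
          (isPseudocomplement (xs zero))
      ; plus xs → describes-resp dualPseudocomplement xs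
          (⟦⟧-cong (inj₂ plus) (pointwise₁ refl))
          (isDualPseudocomplement (xs zero))
      }
      where
      open IsRDBLP A∈V
      open Properties isBoundedDistributiveLattice

    isRegularReduct : IsRDBLP A → IsRegularReduct
    isRegularReduct A∈V =
      P.isRegularReduct
        isPseudocomplement
        isDualPseudocomplement
        regular
      where
      open IsRDBLP A∈V
      module P = Properties isBoundedDistributiveLattice

    isMember : IsRegularReduct → IsDescribed → IsRDBLP A
    isMember isReg d = record
      { isBoundedDistributiveLattice = IsRegularReduct.isBoundedDistributiveLattice isReg
      ; isPseudocomplement           = λ x → d star (x ∷ᵛ []ᵛ)
      ; isDualPseudocomplement       = λ x → d plus (x ∷ᵛ []ᵛ)
      ; regular                      = satisfiesM
          (λ x → d star (x ∷ᵛ []ᵛ))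
          (λ x → d plus (x ∷ᵛ []ᵛ))
      }
      where open RegularProperties isReg

rdpch : ∀ {c ℓ} → Presentation (RDPCH c ℓ)
rdpch {c} {ℓ} = record
  { operation       = operation
  ; _⋆              = λ t → app (inj₂ imp) (t ∷ᵛ 𝟎ᵗ ∷ᵛ []ᵛ)
  ; _⁺              = λ t → app (inj₂ plus) (t ∷ᵛ []ᵛ)
  ; isRegularReduct = isRegularReduct
  ; isDescribed     = isDescribed
  ; isMember        = isMember
  ; ⋆-describes     = λ {A} A∈V t ρ → let open Reduct.RegularProperties A (isRegularReduct A∈V) in
        -- A constant has no arguments, so pointwise equality of the two empty vectors is vacuous.
        implication⇒pseudocomplement (Algebra.⟦⟧-cong A (inj₁ bot) λ ())
          (isDescribed A∈V imp _)
  ; ⁺-describes     = λ A∈V t ρ → isDescribed A∈V plus _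
  }
  where
  operation : ∀ f → Operation (arity DPCHSignature f)
  operation imp  = implication
  operation plus = dualPseudocomplement

  module _ {A : Algebra (expansion DPCHSignature) c ℓ} where
    open LatticeReduct A
    open Reduct A

    IsDescribed : Set (c ⊔ ℓ)
    IsDescribed = ∀ f xs → Describes (operation f) xs (⟦ inj₂ f ⟧ xs)

    isDescribed : IsRDPCH A → IsDescribed
    isDescribed A∈V = λ
      { imp xs → describes-resp implication xs
          (⟦⟧-cong (inj₂ imp) (pointwise₂ refl refl))
          (isImplication (xs zero) (xs (suc zero)))
      ; plus xs → describes-resp dualPseudocomplement xs
          (⟦⟧-cong (inj₂ plus) (pointwise₁ refl))
          (isDualPseudocomplement (xs zero))
      }
      where
      open IsRDPCH A∈V
      open Properties isBoundedDistributiveLattice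

    isRegularReduct : IsRDPCH A → IsRegularReduct
    isRegularReduct A∈V =
      P.isRegularReduct
        -- The second argument is `𝟎` itself here, not an evaluated `𝟎ᵗ`, so `refl` suffices.
        (λ x → P.implication⇒pseudocomplement refl (isImplication x 𝟎))
        isDualPseudocomplement
        regular
      where
      open IsRDPCH A∈V
      module P = Properties isBoundedDistributiveLattice

    isMember : IsRegularReduct → IsDescribed → IsRDPCH A
    isMember isReg d = record
      { isBoundedDistributiveLattice = IsRegularReduct.isBoundedDistributiveLattice isReg
      ; isImplication                = λ x y → d imp (x ∷ᵛ y ∷ᵛ []ᵛ)
      ; isDualPseudocomplement       = λ x → d plus (x ∷ᵛ []ᵛ)
      ; regular                      = satisfiesM
          (λ x → implication⇒pseudocomplement refl (d imp (x ∷ᵛ 𝟎 ∷ᵛ []ᵛ)))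
          (λ x → d plus (x ∷ᵛ []ᵛ))
      }
      where open RegularProperties isReg

rpchᵈ : ∀ {c ℓ} → Presentation (RPCHᵈ c ℓ)
rpchᵈ {c} {ℓ} = record
  { operation       = operation
  ; _⋆              = λ t → app (inj₂ star) (t ∷ᵛ []ᵛ)
  ; _⁺              = λ t → app (inj₂ coimp) (t ∷ᵛ 𝟏ᵗ ∷ᵛ []ᵛ)
  ; isRegularReduct = isRegularReduct
  ; isDescribed     = isDescribed
  ; isMember        = isMember
  ; ⋆-describes     = λ A∈V t ρ → isDescribed A∈V star _
  ; ⁺-describes     = λ {A} A∈V t ρ → let open Reduct.RegularProperties A (isRegularReduct A∈V) in
        dualImplication⇒dualPseudocomplement (Algebra.⟦⟧-cong A (inj₁ top) λ ())
          (isDescribed A∈V coimp _)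
  }
  where
  operation : ∀ f → Operation (arity PCHᵈSignature f)
  operation star  = pseudocomplement
  operation coimp = dualImplication

  module _ {A : Algebra (expansion PCHᵈSignature) c ℓ} where
    open LatticeReduct A
    open Reduct A

    IsDescribed : Set (c ⊔ ℓ)
    IsDescribed = ∀ f xs → Describes (operation f) xs (⟦ inj₂ f ⟧ xs)

    isDescribed : IsRPCHᵈ A → IsDescribed
    isDescribed A∈V = λ
      { star xs → describes-resp pseudocomplement xs
          (⟦⟧-cong (inj₂ star) (pointwise₁ refl))
          (isPseudocomplement (xs zero))
      ; coimp xs → describes-resp dualImplication xs
          (⟦⟧-cong (inj₂ coimp) (pointwise₂ refl refl))
          (isDualImplication (xs zero) (xs (suc zero)))
      }
      where
      open IsRPCHᵈ A∈V
      open Properties isBoundedDistributiveLattice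

    isRegularReduct : IsRPCHᵈ A → IsRegularReduct
    isRegularReduct A∈V =
      P.isRegularReduct
        isPseudocomplement
        (λ x → P.dualImplication⇒dualPseudocomplement refl (isDualImplication x 𝟏))
        regular
      where
      open IsRPCHᵈ A∈V
      module P = Properties isBoundedDistributiveLattice

    isMember : IsRegularReduct → IsDescribed → IsRPCHᵈ A
    isMember isReg d = record
      { isBoundedDistributiveLattice = IsRegularReduct.isBoundedDistributiveLattice isReg
      ; isPseudocomplement           = λ x → d star (x ∷ᵛ []ᵛ)
      ; isDualImplication            = λ x y → d coimp (x ∷ᵛ y ∷ᵛ []ᵛ)
      ; regular                      = satisfiesM
          (λ x → d star (x ∷ᵛ []ᵛ))
          (λ x → dualImplication⇒dualPseudocomplement refl (d coimp (x ∷ᵛ 𝟏 ∷ᵛ []ᵛ)))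
      }
      where open RegularProperties isReg

rdblh : ∀ {c ℓ} → Presentation (RDBLH c ℓ)
rdblh {c} {ℓ} = record
  { operation       = operation
  ; _⋆              = λ t → app (inj₂ imp) (t ∷ᵛ 𝟎ᵗ ∷ᵛ []ᵛ)
  ; _⁺              = λ t → app (inj₂ coimp) (t ∷ᵛ 𝟏ᵗ ∷ᵛ []ᵛ)
  ; isRegularReduct = isRegularReduct
  ; isDescribed     = isDescribed
  ; isMember        = isMember
  ; ⋆-describes     = λ {A} A∈V t ρ → let open Reduct.RegularProperties A (isRegularReduct A∈V) in
        implication⇒pseudocomplement (Algebra.⟦⟧-cong A (inj₁ bot) λ ())
          (isDescribed A∈V imp _)
  ; ⁺-describes     = λ {A} A∈V t ρ → let open Reduct.RegularProperties A (isRegularReduct A∈V) in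
        dualImplication⇒dualPseudocomplement (Algebra.⟦⟧-cong A (inj₁ top) λ ())
          (isDescribed A∈V coimp _)
  }
  where
  operation : ∀ f → Operation (arity DBLHSignature f)
  operation imp   = implication
  operation coimp = dualImplication

  module _ {A : Algebra (expansion DBLHSignature) c ℓ} where
    open LatticeReduct A
    open Reduct A

    IsDescribed : Set (c ⊔ ℓ)
    IsDescribed = ∀ f xs → Describes (operation f) xs (⟦ inj₂ f ⟧ xs)

    isDescribed : IsRDBLH A → IsDescribed
    isDescribed A∈V = λ
      { imp xs → describes-resp implication xs
          (⟦⟧-cong (inj₂ imp) (pointwise₂ refl refl))
          (isImplication (xs zero) (xs (suc zero)))
      ; coimp xs → describes-resp dualImplication xs
          (⟦⟧-cong (inj₂ coimp) (pointwise₂ refl refl))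
          (isDualImplication (xs zero) (xs (suc zero)))
      }
      where
      open IsRDBLH A∈V
      open Properties isBoundedDistributiveLattice

    isRegularReduct : IsRDBLH A → IsRegularReduct
    isRegularReduct A∈V =
      P.isRegularReduct
        (λ x → P.implication⇒pseudocomplement refl (isImplication x 𝟎))
        (λ x → P.dualImplication⇒dualPseudocomplement refl (isDualImplication x 𝟏))
        regular
      where
      open IsRDBLH A∈V
      module P = Properties isBoundedDistributiveLattice

    isMember : IsRegularReduct → IsDescribed → IsRDBLH A
    isMember isReg d = record
      { isBoundedDistributiveLattice = IsRegularReduct.isBoundedDistributiveLattice isReg
      ; isImplication                = λ x y → d imp (x ∷ᵛ y ∷ᵛ []ᵛ)
      ; isDualImplication            = λ x y → d coimp (x ∷ᵛ y ∷ᵛ []ᵛ)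
      ; regular                      = satisfiesM
          (λ x → implication⇒pseudocomplement refl (d imp (x ∷ᵛ 𝟎 ∷ᵛ []ᵛ)))
          (λ x → dualImplication⇒dualPseudocomplement refl (d coimp (x ∷ᵛ 𝟏 ∷ᵛ []ᵛ)))
      }
      where open RegularProperties isReg

corollary2p6 : (c ℓ : Level) →
    AllPairs TermEquivalent
    (RDBLP c ℓ ∷ RDPCH c ℓ ∷ RPCHᵈ c ℓ ∷ RDBLH c ℓ ∷ [])
corollary2p6 c ℓ =
  -- Term equivalence is symmetric, so the six unordered pairs cover all cases; each comes directly
  -- from two presentations.
  (termEquivalent rdblp rdpch ∷ termEquivalent rdblp rpchᵈ ∷ termEquivalent rdblp rdblh ∷ []) ∷
  (termEquivalent rdpch rpchᵈ ∷ termEquivalent rdpch rdblh ∷ []) ∷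
  (termEquivalent rpchᵈ rdblh ∷ []) ∷
  [] ∷
  []
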